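{- Let $(\mathbf T,\mathbf C,\mathbf A)$ (with its operators and substitution functions) be an original psi-calculus over a countably infinite set $\mathcal N$ of names, and suppose that $\mathrm n(N\sigma)\supseteq \mathrm n(N)\setminus\mathrm n(\sigma)$ for all terms $N\in\mathbf T$ and all substitutions $\sigma$. Let $\mathbf X=\mathbf T$ (with the same substitution function), $\mathrm{vars}(X)=\mathcal P(\mathrm n(X))$, $\mathrm{Match}(M,\tilde x,X)=\{\tilde L : M=X[\tilde x:=\tilde L]\}$, $\mathcal S=\mathcal S_{\mathcal N}=\mathcal S_\nu=\{s\}$, $\underline{\propto}=\overline{\propto}=\prec\,=\{(s,s)\}$, and $\mathrm{SORT}:\mathcal N\uplus\mathbf T\uplus\mathbf X\to\{s\}$. Then $(\mathbf T,\mathbf X,\mathbf C,\mathbf A)$ with these parameters is a sorted psi-calculus.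
   Context: **Nominal sets.** Names are partitioned into countably infinite sets $\mathcal N_s$, one for each name sort $s\in\mathcal S_{\mathcal N}$; $\mathcal N=\bigcup_s\mathcal N_s$. A tilde denotes a finite tuple; $\tilde x$ also denotes the set of its entries. Swappings $(a\ b)$ are only considered for names of the same sort; $(\tilde a\ \tilde b)$ is the pointwise swapping of equally long tuples. A nominal set is a set with an action of these swappings in which each element $T$ has finite support $\mathrm n(T)\subset\mathcal N$; $a\#T$ means $a\notin \mathrm n(T)$, extended to tuples by conjunction. Functions, relations and constants are equivariant if preserved by all swappings; every sort is equivariant. $\mathcal P$ and $\mathcal P_{\rm fin}$ denote power set and set of finite subsets. **Logical parameters.** Nominal sets $\mathbf T$ (terms), $\mathbf C$ (conditions), $\mathbf A$ (assertions), with equivariant $\leftrightarrow:\mathbf T\times\mathbf T\to\mathbf C$ (channel equivalence), $\otimes:\mathbf A\times\mathbf A\to\mathbf A$, $\mathbf 1\in\mathbf A$, $\vdash\;\subseteq\mathbf A\times\mathbf C$. Write $\Psi\simeq\Psi'$ if $\Psi\vdash\varphi\Leftrightarrow\Psi'\vdash\varphi$ for all $\varphi\in\mathbf C$. Required: $\Psi\vdash M\leftrightarrow N$ implies $\Psi\vdash N\leftrightarrow M$; $\Psi\vdash M\leftrightarrow N$ and $\Psi\vdash N\leftrightarrow L$ imply $\Psi\vdash M\leftrightarrow L$; $\Psi_1\simeq\Psi_2$ implies $\Psi\otimes\Psi_1\simeq\Psi\otimes\Psi_2$; $(\mathbf A,\otimes,\mathbf 1)$ is an abelian monoid modulo $\simeq$.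 **Original psi-calculus.** There is a single sort of names. It consists of logical parameters $\mathbf T,\mathbf C,\mathbf A,\leftrightarrow,\otimes,\mathbf 1,\vdash$ together with, on each of $\mathbf T,\mathbf C,\mathbf A$, an equivariant substitution function $T\mapsto T[\tilde a:=\tilde N]$, for $\tilde a$ a tuple of distinct names and $\tilde N$ an equally long tuple of terms, such that (i) if $\tilde a\subseteq\mathrm n(T)$ and $b\in\mathrm n(\tilde N)$ then $b\in\mathrm n(T[\tilde a:=\tilde N])$; (ii) if $\tilde b\#T,\tilde a$ then $T[\tilde a:=\tilde N]=((\tilde a\ \tilde b)\cdot T)[\tilde b:=\tilde N]$. For $\sigma=[\tilde a:=\tilde N]$, $\mathrm n(\sigma)=\mathrm n(\tilde a)\cup\mathrm n(\tilde N)$. **Sorted psi-calculus.** It consists of a set of sorts $\mathcal S$, name sorts $\mathcal S_{\mathcal N}\subseteq\mathcal S$ (countable), logical parameters $\mathbf T,\mathbf C,\mathbf A,\leftrightarrow,\otimes,\mathbf 1,\vdash$, and: - a nominal set $\mathbf X$ of patterns, and equivariant $\mathrm{Match}:\mathbf T\times\mathcal N^*\times\mathbf X\to\mathcal P_{\rm fin}(\mathbf T^*)$ and $\mathrm{vars}:\mathbf X\to\mathcal P_{\rm fin}(\mathcal P_{\rm fin}(\mathcal N))$; - an equivariant $\mathrm{SORT}:\mathcal N\uplus\mathbf T\uplus\mathbf X\to\mathcal S$ with $\mathrm{SORT}(a)=s$ iff $a\in\mathcal N_s$, and predicates $\underline\propto$ (can receive), $\overline\propto$ (can send), $\prec$ (can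 be substituted by) $\subseteq\mathcal S\times\mathcal S$ and $\mathcal S_\nu\subseteq\mathcal S_{\mathcal N}$ (restrictable sorts). Define $s_1\le_{\mathbf T}s_2$ iff for all $t\in\mathcal S$: $(s_2\underline\propto t\Rightarrow s_1\underline\propto t)$, $(s_2\overline\propto t\Rightarrow s_1\overline\propto t)$ and $(t\overline\propto s_2\Rightarrow t\overline\propto s_1)$; and $s_1\le_{\mathbf X}s_2$ iff for all $t\in\mathcal S$: $t\underline\propto s_2\Rightarrow t\underline\propto s_1$. A substitution $\sigma=[\tilde a:=\tilde N]$ consists of a tuple of distinct names and an equally long tuple of terms with $\mathrm{SORT}(a_i)\prec\mathrm{SORT}(N_i)$ for all $i$. Requirements on substitution: on each of $\mathbf T,\mathbf C,\mathbf A$ there is an equivariant substitution function satisfying: if $\tilde b\#T,\tilde a$ then $T[\tilde a:=\tilde N]=((\tilde a\ \tilde b)\cdot T)[\tilde b:=\tilde N]$ (alpha-renaming); for terms also $\mathrm{SORT}(M\sigma)\le_{\mathbf T}\mathrm{SORT}(M)$. On $\mathbf X$ there is an equivariant substitution function such that if $\tilde x\in\mathrm{vars}(X)$ and $\tilde x\#\sigma$, where $\sigma=[\tilde a:=\tilde N]$, then $\mathrm{SORT}(X\sigma)\le_{\mathbf X}\mathrm{SORT}(X)$, $\tilde x\in\mathrm{vars}(X\sigma)$, and $X[\tilde a:=\tilde N]=((\tilde a\ \tilde b)\cdot X)[\tilde b:=\tilde N]$ whenever $\tilde b\#X,\tilde a$ (alpha-renaming for $\sigma$ and $X$). Requirements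 on matching: if $\tilde x\in\mathrm{vars}(X)$ are distinct and $\tilde N\in\mathrm{Match}(M,\tilde x,X)$ then $[\tilde x:=\tilde N]$ is a substitution, $\mathrm n(\tilde N)\subseteq\mathrm n(M)\cup(\mathrm n(X)\setminus\tilde x)$, and for all swappings $(\tilde x\ \tilde y)$ with $\tilde y\#X$ we have $\tilde N\in\mathrm{Match}(M,\tilde y,(\tilde x\ \tilde y)\cdot X)$. In the definition of $\mathrm{Match}$ in the claim, $\tilde L$ ranges over those tuples for which $[\tilde x:=\tilde L]$ is a substitution.
   Formalization: Match is allowed values in P(T*) rather than P_fin(T*): finiteness fails in general (for T = N with ordinary substitution, Match(a,(x),a) = T is infinite when x ≠ a); all other requirements are kept, with ỹ in the last matching requirement taken distinct. -}

module Defs where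

open import Level using (Level; 0ℓ; _⊔_) renaming (suc to lsuc)
open import Algebra.Structures using (IsCommutativeMonoid)
open import Data.List.Base using (List; map; foldr; concatMap; _++_)
open import Data.List.Membership.Propositional using (_∈_; _∉_)
open import Data.List.Relation.Binary.BagAndSetEquality using (_∼[_]_; set)
open import Data.List.Relation.Binary.Pointwise using (Pointwise)
open import Data.List.Relation.Binary.Subset.Propositional using (_⊆_)
open import Data.List.Relation.Unary.All using (All)
open import Data.List.Relation.Unary.Any using (Any)
open import Data.List.Relation.Unary.Unique.Propositional using (Unique)
open import Data.Nat.Base using (ℕ)
import Data.Nat.Properties as ℕ
open import Data.Product.Base using (Σ-syntax; ∃; ∃-syntax; _×_; _,_; proj₁)
open import Data.Sum.Base using (_⊎_)
open import Data.Unit.Base using (⊤; tt)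
open import Function.Base using (_∘_)
open import Function.Bundles using (_↔_; _⇔_; Inverse; mk↔ₛ′)
open import Relation.Binary.Bundles using (Setoid)
open import Relation.Binary.Core using (Rel)
open import Relation.Binary.Definitions using (DecidableEquality)
open import Relation.Binary.PropositionalEquality.Core
  using (_≡_; refl; sym; trans; cong)
open import Relation.Nullary using (Dec; yes; no)
open import Relation.Unary using (Pred)

-- 𝒩_s is the fibre of `sort` over s, so "SORT(a) = s iff a ∈ 𝒩_s" holds by
-- construction.  `code` says that the set of name sorts is countable.
record NameUniverse : Set₁ where
  field
    Sort           : Set
    IsNameSort     : Pred Sort 0ℓ
    code           : ∀ {s} → IsNameSort s → ℕ
    code-injective : ∀ {s t} (p : IsNameSort s) (q : IsNameSort t) →
                     code p ≡ code q → s ≡ t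
    Name           : Set
    sort           : Name → Sort
    sort-isName    : ∀ a → IsNameSort (sort a)
    enumerate      : ∀ {s} → IsNameSort s → ℕ ↔ (∃[ a ] sort a ≡ s)

  private
    sortCode : Name → ℕ
    sortCode a = code (sort-isName a)

    fibre-≡ : ∀ {s} (p : IsNameSort s) (x y : ∃[ a ] sort a ≡ s) →
              Inverse.from (enumerate p) x ≡ Inverse.from (enumerate p) y → x ≡ y
    fibre-≡ p x y eq =
      trans (sym (Inverse.strictlyInverseˡ (enumerate p) x))
        (trans (cong (Inverse.to (enumerate p)) eq)
          (Inverse.strictlyInverseˡ (enumerate p) y))

    pair-≡ : ∀ {a b} → a ≡ b → (e : sort a ≡ sort b) →
             _≡_ {A = ∃[ c ] sort c ≡ sort b} (a , e) (b , refl)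
    pair-≡ refl refl = refl

  _≟_ : DecidableEquality Name
  a ≟ b with sortCode a ℕ.≟ sortCode b
  ... | no  ≢c = no (≢c ∘ cong sortCode)
  ... | yes ≡c = byIndex (code-injective _ _ ≡c)
    where
    index : ∃[ c ] sort c ≡ sort b → ℕ
    index = Inverse.from (enumerate (sort-isName b))

    byIndex : sort a ≡ sort b → Dec (a ≡ b)
    byIndex e with index (a , e) ℕ.≟ index (b , refl)
    ... | yes ≡i = yes (cong proj₁ (fibre-≡ (sort-isName b) (a , e) (b , refl) ≡i))
    ... | no  ≢i = no λ a≡b → ≢i (cong index (pair-≡ a≡b e))

singleSorted : (𝒩 : Set) → ℕ ↔ 𝒩 → NameUniverse
singleSorted 𝒩 enum = record
  { Sort           = ⊤
  ; IsNameSort     = λ _ → ⊤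
  ; code           = λ _ → 0
  ; code-injective = λ _ _ _ → refl
  ; Name           = 𝒩
  ; sort           = λ _ → tt
  ; sort-isName    = λ _ → tt
  ; enumerate      = λ _ → mk↔ₛ′ (λ i → to i , refl) (from ∘ proj₁)
                       (λ { (a , refl) → cong (_, refl) (strictlyInverseˡ a) })
                       strictlyInverseʳ
  }
  where open Inverse enum

------------------------------------------------------------------------

module Nominal (𝒰 : NameUniverse) where
  open NameUniverse 𝒰

  record Swapping : Set where
    constructor swapping
    field
      left right : Name
      sameSort   : sort left ≡ sort right

  open Swapping public

  infixr 8 _∙ₙ_ _∙ₜ_

  _∙ₙ_ : Swapping → Name → Name
  π ∙ₙ a with a ≟ left π | a ≟ right π
  ... | yes _ | _     = right π
  ... | no  _ | yes _ = left π
  ... | no  _ | no  _ = a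

  ∙ₙ-sort : ∀ π a → sort (π ∙ₙ a) ≡ sort a
  ∙ₙ-sort π a with a ≟ left π | a ≟ right π
  ... | yes refl | _        = sym (sameSort π)
  ... | no  _    | yes refl = sameSort π
  ... | no  _    | no  _    = refl

  _∙ₜ_ : Swapping → List Name → List Name
  π ∙ₜ ã = map (π ∙ₙ_) ã

  _∙ₛ_ : Swapping → Swapping → Swapping
  π ∙ₛ ρ = swapping (π ∙ₙ left ρ) (π ∙ₙ right ρ)
    (trans (∙ₙ-sort π (left ρ)) (trans (sameSort ρ) (sym (∙ₙ-sort π (right ρ)))))

  -- The element equality of a nominal set may be any equivalence (e.g. alpha
  -- equivalence).  `n` lists the least finite support.
  record NominalSet (c ℓ : Level) : Set (lsuc (c ⊔ ℓ)) where
    infixr 8 _∙_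
    field
      setoid : Setoid c ℓ

    open Setoid setoid public

    field
      _∙_            : Swapping → Carrier → Carrier
      ∙-cong         : ∀ π {x y} → x ≈ y → (π ∙ x) ≈ (π ∙ y)
      ∙-trivial      : ∀ π x → left π ≡ right π → (π ∙ x) ≈ x
      ∙-involutive   : ∀ π x → (π ∙ π ∙ x) ≈ x
      ∙-distributive : ∀ π ρ x → (π ∙ ρ ∙ x) ≈ ((π ∙ₛ ρ) ∙ π ∙ x)

    Supports : List Name → Carrier → Set ℓ
    Supports ã x = ∀ π → left π ∉ ã → right π ∉ ã → (π ∙ x) ≈ x

    field
      n          : Carrier → List Name
      n-supports : ∀ x → Supports (n x) x
      n-least    : ∀ x ã → Supports ã x → n x ⊆ ã

    infix 4 _#_ _≋_

    _#_ : List Name → Carrier → Set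
    ã # x = All (_∉ n x) ã

    _≋_ : Rel (List Carrier) (c ⊔ ℓ)
    _≋_ = Pointwise _≈_

    n* : List Carrier → List Name
    n* = concatMap n

    -- (ã b̃) ∙* x, where ã and b̃ are the left and right entries of the list.
    _∙*_ : List Swapping → Carrier → Carrier
    πs ∙* x = foldr _∙_ x πs

  infix 4 _#ₜ_

  _#ₜ_ : List Name → List Name → Set
  b̃ #ₜ ã = All (_∉ ã) b̃

  open NominalSet using (Carrier)

  record LogicalParameters (c ℓ : Level) : Set (lsuc (c ⊔ ℓ)) where
    field
      𝐓 𝐂 𝐀 : NominalSet c ℓ

    module T = NominalSet 𝐓
    module C = NominalSet 𝐂
    module A = NominalSet 𝐀

    infixr 7 _⊗_
    infix  6 _↔̇_
    infix  4 _⊢_ _≃_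

    field
      _↔̇_ : T.Carrier → T.Carrier → C.Carrier
      _⊗_ : A.Carrier → A.Carrier → A.Carrier
      𝟏   : A.Carrier
      _⊢_ : A.Carrier → C.Carrier → Set ℓ

    _≃_ : Rel A.Carrier (c ⊔ ℓ)
    Ψ ≃ Ψ′ = ∀ φ → (Ψ ⊢ φ) ⇔ (Ψ′ ⊢ φ)

    field
      ↔̇-cong : ∀ {M M′ N N′} → M T.≈ M′ → N T.≈ N′ → (M ↔̇ N) C.≈ (M′ ↔̇ N′)
      ⊗-cong : ∀ {Ψ₁ Ψ₁′ Ψ₂ Ψ₂′} → Ψ₁ A.≈ Ψ₁′ → Ψ₂ A.≈ Ψ₂′ →
               (Ψ₁ ⊗ Ψ₂) A.≈ (Ψ₁′ ⊗ Ψ₂′)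
      ⊢-resp : ∀ {Ψ Ψ′ φ φ′} → Ψ A.≈ Ψ′ → φ C.≈ φ′ → Ψ ⊢ φ → Ψ′ ⊢ φ′

      ↔̇-equivariant : ∀ π M N → (π C.∙ (M ↔̇ N)) C.≈ ((π T.∙ M) ↔̇ (π T.∙ N))
      ⊗-equivariant : ∀ π Ψ Ψ′ → (π A.∙ (Ψ ⊗ Ψ′)) A.≈ ((π A.∙ Ψ) ⊗ (π A.∙ Ψ′))
      𝟏-equivariant : ∀ π → (π A.∙ 𝟏) A.≈ 𝟏
      ⊢-equivariant : ∀ π {Ψ φ} → Ψ ⊢ φ → (π A.∙ Ψ) ⊢ (π C.∙ φ)

      channel-symmetric   : ∀ {Ψ M N} → Ψ ⊢ M ↔̇ N → Ψ ⊢ N ↔̇ M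
      channel-transitive  : ∀ {Ψ M N L} → Ψ ⊢ M ↔̇ N → Ψ ⊢ N ↔̇ L → Ψ ⊢ M ↔̇ L
      compositional       : ∀ {Ψ Ψ₁ Ψ₂} → Ψ₁ ≃ Ψ₂ → (Ψ ⊗ Ψ₁) ≃ (Ψ ⊗ Ψ₂)
      isCommutativeMonoid : IsCommutativeMonoid _≃_ _⊗_ 𝟏

  -- `Admissible a N` is the condition on the pairs of a substitution: none in
  -- the original calculus (where Pointwise only forces equal lengths),
  -- SORT(a) ≺ SORT(N) in a sorted one.
  module Substitutions {c ℓ} (𝐓 : NominalSet c ℓ)
                       (Admissible : Name → Carrier 𝐓 → Set) where
    private module T = NominalSet 𝐓

    IsSubstitution : List Name → List T.Carrier → Set c
    IsSubstitution ã Ñ = Unique ã × Pointwise Admissible ã Ñ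

    record Substitution : Set c where
      constructor substitution
      field
        dom            : List Name
        img            : List T.Carrier
        isSubstitution : IsSubstitution dom img

    open Substitution public

    nσ : Substitution → List Name
    nσ σ = dom σ ++ T.n* (img σ)

    record SubstitutionFunction (𝐙 : NominalSet c ℓ) : Set (c ⊔ ℓ) where
      private module Z = NominalSet 𝐙

      infixl 9 _[_]

      field
        _[_]        : Z.Carrier → Substitution → Z.Carrier
        []-cong     : ∀ {x y σ τ} → x Z.≈ y → dom σ ≡ dom τ → img σ T.≋ img τ →
                      (x [ σ ]) Z.≈ (y [ τ ])
        -- The hypotheses say that τ is the substitution π ∙ σ.
        equivariant : ∀ π x σ τ → dom τ ≡ π ∙ₜ dom σ → img τ T.≋ map (π T.∙_) (img σ) →
                      (π Z.∙ (x [ σ ])) Z.≈ ((π Z.∙ x) [ τ ])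

      -- If b̃ # x, ã then x[ã:=Ñ] = ((ã b̃) ∙ x)[b̃:=Ñ], with σ = [ã:=Ñ] and
      -- τ = [b̃:=Ñ].
      AlphaRenaming : Z.Carrier → Substitution → Set (c ⊔ ℓ)
      AlphaRenaming x σ =
        ∀ (πs : List Swapping) (τ : Substitution) →
        dom σ ≡ map left πs → dom τ ≡ map right πs → img σ T.≋ img τ →
        dom τ Z.# x → dom τ #ₜ dom σ →
        (x [ σ ]) Z.≈ ((πs Z.∙* x) [ τ ])

      PreservesNames : Set c
      PreservesNames = ∀ x σ b → dom σ ⊆ Z.n x → b ∈ T.n* (img σ) → b ∈ Z.n (x [ σ ])

------------------------------------------------------------------------

record OriginalPsiCalculus (𝒩 : Set) (enum : ℕ ↔ 𝒩) (c ℓ : Level) :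
                           Set (lsuc (c ⊔ ℓ)) where
  open Nominal (singleSorted 𝒩 enum) public

  field
    logical : LogicalParameters c ℓ

  open LogicalParameters logical public
  open Substitutions 𝐓 (λ _ _ → ⊤) public

  field
    substT : SubstitutionFunction 𝐓
    substC : SubstitutionFunction 𝐂
    substA : SubstitutionFunction 𝐀

  module SubstT = SubstitutionFunction substT
  module SubstC = SubstitutionFunction substC
  module SubstA = SubstitutionFunction substA

  field
    preservesT : SubstT.PreservesNames
    preservesC : SubstC.PreservesNames
    preservesA : SubstA.PreservesNames
    alphaT     : ∀ M σ → SubstT.AlphaRenaming M σ
    alphaC     : ∀ φ σ → SubstC.AlphaRenaming φ σ
    alphaA     : ∀ Ψ σ → SubstA.AlphaRenaming Ψ σ

-- The data of a sorted psi-calculus.  Subsets (of 𝒫_fin(𝒩) for vars, of 𝐓*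
-- for Match) are predicates; a tuple x̃ stands for the set of its entries in
-- `vars X x̃`.
record SortedParameters (c ℓ : Level) : Set (lsuc (c ⊔ ℓ)) where
  field
    names : NameUniverse

  open NameUniverse names public
  open Nominal names public

  field
    logical : LogicalParameters c ℓ
    𝐗       : NominalSet c ℓ

  open LogicalParameters logical public
  module X = NominalSet 𝐗

  infix 4 _∝̲_ _∝̅_ _≺_

  field
    Match           : T.Carrier → List Name → X.Carrier → Pred (List T.Carrier) (c ⊔ ℓ)
    vars            : X.Carrier → Pred (List Name) 0ℓ
    SORTₜ           : T.Carrier → Sort
    SORTₓ           : X.Carrier → Sort
    _∝̲_ _∝̅_ _≺_    : Rel Sort 0ℓ
    IsRestrictable  : Pred Sort 0ℓ

  open Substitutions 𝐓 (λ a N → sort a ≺ SORTₜ N) public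

  field
    substT : SubstitutionFunction 𝐓
    substC : SubstitutionFunction 𝐂
    substA : SubstitutionFunction 𝐀
    substX : SubstitutionFunction 𝐗

  module SubstT = SubstitutionFunction substT
  module SubstC = SubstitutionFunction substC
  module SubstA = SubstitutionFunction substA
  module SubstX = SubstitutionFunction substX

  infix 4 _≤ₜ_ _≤ₓ_

  _≤ₜ_ : Rel Sort 0ℓ
  s₁ ≤ₜ s₂ = ∀ t → (s₂ ∝̲ t → s₁ ∝̲ t) × (s₂ ∝̅ t → s₁ ∝̅ t) × (t ∝̅ s₂ → t ∝̅ s₁)

  _≤ₓ_ : Rel Sort 0ℓ
  s₁ ≤ₓ s₂ = ∀ t → t ∝̲ s₂ → t ∝̲ s₁

-- Match is a function into 𝒫(𝐓*) here.  Requiring its values to be finite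
-- would exclude pattern matching by substitution over ordinary term
-- languages: if x # X and X[x:=L] = X for all L, then every term L is a match
-- of X against itself with pattern variable x.
record IsSortedPsiCalculus {c ℓ} (P : SortedParameters c ℓ) : Set (c ⊔ ℓ) where
  open SortedParameters P

  field
    restrictable-isName : ∀ {s} → IsRestrictable s → IsNameSort s

    SORTₜ-cong        : ∀ {M N} → M T.≈ N → SORTₜ M ≡ SORTₜ N
    SORTₜ-equivariant : ∀ π M → SORTₜ (π T.∙ M) ≡ SORTₜ M
    SORTₓ-cong        : ∀ {X Y} → X X.≈ Y → SORTₓ X ≡ SORTₓ Y
    SORTₓ-equivariant : ∀ π X → SORTₓ (π X.∙ X) ≡ SORTₓ X

    vars-resp        : ∀ {X Y x̃ ỹ} → X X.≈ Y → x̃ ∼[ set ] ỹ → vars X x̃ → vars Y ỹ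
    vars-finite      : ∀ X → ∃[ vs ] (∀ x̃ → vars X x̃ ⇔ Any (x̃ ∼[ set ]_) vs)
    vars-equivariant : ∀ π {X x̃} → vars X x̃ → vars (π X.∙ X) (π ∙ₜ x̃)

    Match-resp        : ∀ {M N x̃ X Y L̃ Ñ} → M T.≈ N → X X.≈ Y → L̃ T.≋ Ñ →
                        Match M x̃ X L̃ → Match N x̃ Y Ñ
    Match-equivariant : ∀ π {M x̃ X L̃} → Match M x̃ X L̃ →
                        Match (π T.∙ M) (π ∙ₜ x̃) (π X.∙ X) (map (π T.∙_) L̃)

    alphaT     : ∀ M σ → SubstT.AlphaRenaming M σ
    alphaC     : ∀ φ σ → SubstC.AlphaRenaming φ σ
    alphaA     : ∀ Ψ σ → SubstA.AlphaRenaming Ψ σ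
    subst-sort : ∀ M σ → SORTₜ (M SubstT.[ σ ]) ≤ₜ SORTₜ M

    substX-requirements : ∀ X σ x̃ → vars X x̃ → x̃ #ₜ nσ σ →
      (SORTₓ (X SubstX.[ σ ]) ≤ₓ SORTₓ X) ×
      vars (X SubstX.[ σ ]) x̃ ×
      SubstX.AlphaRenaming X σ

    match-substitution : ∀ {M x̃ X Ñ} → vars X x̃ → Unique x̃ → Match M x̃ X Ñ →
                         IsSubstitution x̃ Ñ
    match-names        : ∀ {M x̃ X Ñ} → vars X x̃ → Unique x̃ → Match M x̃ X Ñ →
                         ∀ b → b ∈ T.n* Ñ → b ∈ T.n M ⊎ (b ∈ X.n X × b ∉ x̃)
    -- A swapping (x̃ ỹ) of tuples is only defined when ỹ, like x̃, is distinct.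
    match-alpha        : ∀ {M x̃ X Ñ} → vars X x̃ → Unique x̃ → Match M x̃ X Ñ →
                         ∀ (πs : List Swapping) → x̃ ≡ map left πs →
                         Unique (map right πs) → map right πs X.# X →
                         Match M (map right πs) (πs X.∙* X) Ñ

module _ {𝒩 : Set} {enum : ℕ ↔ 𝒩} {c ℓ} (O : OriginalPsiCalculus 𝒩 enum c ℓ) where
  open OriginalPsiCalculus O

  sortedParameters : SortedParameters c ℓ
  sortedParameters = record
    { names          = singleSorted 𝒩 enum
    ; logical        = logical
    ; 𝐗              = 𝐓
    ; Match          = λ M x̃ X L̃ → Σ[ p ∈ IsSubstitution x̃ L̃ ]
                                     M T.≈ (X SubstT.[ substitution x̃ L̃ p ])
    ; vars           = λ X x̃ → x̃ ⊆ T.n X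
    ; SORTₜ          = λ _ → tt
    ; SORTₓ          = λ _ → tt
    ; _∝̲_            = λ _ _ → ⊤
    ; _∝̅_            = λ _ _ → ⊤
    ; _≺_            = λ _ _ → ⊤
    ; IsRestrictable = λ _ → ⊤
    ; substT         = substT
    ; substC         = substC
    ; substA         = substA
    ; substX         = substT
    }

  KeepsNames : Set c
  KeepsNames = ∀ N σ b → b ∈ T.n N → b ∉ nσ σ → b ∈ T.n (N SubstT.[ σ ])

{-# OPTIONS --safe #-}
module Submission where

-- Why the theorem holds.  With a single sort and total sort relations, every
-- condition on sorts is trivial, and alpha-renaming is inherited from the
-- original calculus.  What remains concerns vars and Match.
--
-- The tuples in vars X are those with entries in n(X).  They form finitely many
-- sets because any such tuple has the same entries as a sublist of n(X)
-- (⊆⇔∼sublist), and they are equivariant because n is (n-equivariant), which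
-- follows from the minimality of supports.
--
-- If x̃ ⊆ n(X) and M = X[x̃:=L̃], then:
--   * n(L̃) ⊆ n(M), since substitution preserves the names of the substituted
--     terms when all of x̃ occurs in X;
--   * ỹ # X implies ỹ # x̃, so a match can be renamed along (x̃ ỹ) by
--     alpha-renaming;
--   * if x̃ # σ then x̃ ⊆ n(Xσ), which is the hypothesis that substitutions
--     keep the names that they do not mention.

open import Defs
open import Level using (Level)
open import Data.List.Base using (List; []; _∷_; map; _++_; filter)
open import Data.List.Membership.Propositional using (_∈_; _∉_; find; lose)
open import Data.List.Membership.Propositional.Properties
  using (∈-map⁺; ∈-map⁻; ∈-++⁺ˡ; ∈-++⁺ʳ; ∈-++⁻; ∈-filter⁺; ∈-filter⁻)
import Data.List.Membership.DecPropositional as DecMembership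
open import Data.List.Relation.Binary.BagAndSetEquality using (_∼[_]_; set)
import Data.List.Relation.Binary.Pointwise as Pointwise
open import Data.List.Relation.Binary.Subset.Propositional using (_⊆_)
open import Data.List.Relation.Binary.Subset.Propositional.Properties
  using (∷⁺ʳ)
import Data.List.Relation.Unary.All as All
open import Data.List.Relation.Unary.Any using (Any; here; there)
open import Data.List.Relation.Unary.Unique.Propositional using (Unique)
import Data.List.Relation.Unary.Unique.Propositional.Properties as Uniqueₚ
open import Data.Nat.Base using (ℕ)
open import Data.Product.Base using (_,_; proj₁; proj₂)
open import Data.Sum.Base using (inj₁; inj₂)
open import Data.Unit.Base using (⊤; tt)
open import Function.Base using (_∘_)
open import Function.Bundles using (_↔_; _⇔_; mk⇔; Equivalence)
open import Relation.Binary.Definitions using (DecidableEquality)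
open import Relation.Binary.PropositionalEquality.Core
  using (_≡_; refl; sym; trans; cong; subst)
open import Relation.Nullary using (yes; no; contradiction)
open import Relation.Unary using (Pred; Decidable)

private
  variable
    a p : Level
    A : Set a
    xs ys : List A

-- All sublists of a list.  Up to set equality they are all subsets of the set
-- of its entries.
sublists : List A → List (List A)
sublists []       = [] ∷ []
sublists (x ∷ xs) = sublists xs ++ map (x ∷_) (sublists xs)

∈-sublists⇒⊆ : ∀ (xs : List A) → ys ∈ sublists xs → ys ⊆ xs
∈-sublists⇒⊆ [] (here refl) = λ ()
∈-sublists⇒⊆ (x ∷ xs) ys∈ with ∈-++⁻ (sublists xs) ys∈
... | inj₁ ys∈′ = there ∘ ∈-sublists⇒⊆ xs ys∈′
... | inj₂ ys∈′ with ∈-map⁻ (x ∷_) ys∈′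
...   | zs , zs∈ , refl = ∷⁺ʳ x (∈-sublists⇒⊆ xs zs∈)

filter∈sublists : ∀ {P : Pred A p} (P? : Decidable P) xs → filter P? xs ∈ sublists xs
filter∈sublists P? [] = here refl
filter∈sublists P? (x ∷ xs) with P? x
... | yes _ = ∈-++⁺ʳ (sublists xs) (∈-map⁺ (x ∷_) (filter∈sublists P? xs))
... | no  _ = ∈-++⁺ˡ (filter∈sublists P? xs)

module _ {A : Set} (_≟_ : DecidableEquality A) where
  open DecMembership _≟_ using (_∈?_)

  ⊆⇒∼filter : ys ⊆ xs → ys ∼[ set ] filter (_∈? ys) xs
  ⊆⇒∼filter {ys} {xs} ys⊆xs {z} = mk⇔
    (λ z∈ys → ∈-filter⁺ (_∈? ys) (ys⊆xs z∈ys) z∈ys)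
    (proj₂ ∘ ∈-filter⁻ (_∈? ys) {xs = xs})

  -- The witnessing sublist consists of the entries of xs that are in ys.
  ⊆⇔∼sublist : ∀ (xs ys : List A) → ys ⊆ xs ⇔ Any (ys ∼[ set ]_) (sublists xs)
  ⊆⇔∼sublist xs ys = mk⇔ {A = ys ⊆ xs}
    (λ ys⊆xs → lose (filter∈sublists (_∈? ys) xs) λ {_} → ⊆⇒∼filter ys⊆xs)
    (λ any → let _ , zs∈ , ys∼zs = find any in
      ∈-sublists⇒⊆ xs zs∈ ∘ Equivalence.to (ys∼zs {_}))

module NominalProperties (𝒰 : NameUniverse) where
  open NameUniverse 𝒰
  open Nominal 𝒰

  ∙ₙ-left : ∀ π → π ∙ₙ left π ≡ right π
  ∙ₙ-left π with left π ≟ left π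
  ... | yes _ = refl
  ... | no  ≢ = contradiction refl ≢

  ∙ₙ-right : ∀ π → π ∙ₙ right π ≡ left π
  ∙ₙ-right π with right π ≟ left π | right π ≟ right π
  ... | yes r≡l | _     = r≡l
  ... | no  _   | yes _ = refl
  ... | no  _   | no  ≢ = contradiction refl ≢

  ∙ₙ-involutive : ∀ π b → π ∙ₙ (π ∙ₙ b) ≡ b
  ∙ₙ-involutive π b with b ≟ left π in eqˡ | b ≟ right π in eqʳ
  ... | yes refl | _        = ∙ₙ-right π
  ... | no  _    | yes refl = ∙ₙ-left π
  ... | no  _    | no  _    rewrite eqˡ | eqʳ = refl

  ∙ₙ-injective : ∀ π {b d} → π ∙ₙ b ≡ π ∙ₙ d → b ≡ d
  ∙ₙ-injective π {b} {d} eq =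
    trans (sym (∙ₙ-involutive π b)) (trans (cong (π ∙ₙ_) eq) (∙ₙ-involutive π d))

  module _ {c ℓ} (𝐙 : NominalSet c ℓ) where
    open NominalSet 𝐙 renaming (refl to ≈-refl; sym to ≈-sym; trans to ≈-trans)

    n-resp : ∀ {x y} → x ≈ y → n x ⊆ n y
    n-resp {x} {y} x≈y = n-least x (n y) λ π l∉ r∉ →
      ≈-trans (∙-cong π x≈y) (≈-trans (n-supports y π l∉ r∉) (≈-sym x≈y))

    -- Conjugating by π shows that π ∙ n(π ∙ x) supports x, so it contains n(x).
    n-equivariant : ∀ π {x b} → b ∈ n x → π ∙ₙ b ∈ n (π ∙ x)
    n-equivariant π {x} {b} b∈ with ∈-map⁻ (π ∙ₙ_) (n-least x (π ∙ₜ n (π ∙ x)) supports b∈)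
      where
      ∉-shift : ∀ {d} → d ∉ π ∙ₜ n (π ∙ x) → π ∙ₙ d ∉ n (π ∙ x)
      ∉-shift {d} d∉ πd∈ =
        d∉ (subst (_∈ π ∙ₜ n (π ∙ x)) (∙ₙ-involutive π d) (∈-map⁺ (π ∙ₙ_) πd∈))

      supports : Supports (π ∙ₜ n (π ∙ x)) x
      supports ρ l∉ r∉ =
        ≈-trans (≈-sym (∙-involutive π (ρ ∙ x)))
          (≈-trans
            (∙-cong π (≈-trans (∙-distributive π ρ x)
              (n-supports (π ∙ x) (π ∙ₛ ρ) (∉-shift l∉) (∉-shift r∉))))
            (∙-involutive π x))
    ... | d , d∈ , refl = subst (_∈ n (π ∙ x)) (sym (∙ₙ-involutive π d)) d∈

    ∙ₜ-⊆-n : ∀ π {x ã} → ã ⊆ n x → π ∙ₜ ã ⊆ n (π ∙ x)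
    ∙ₜ-⊆-n π ã⊆ b∈ with ∈-map⁻ (π ∙ₙ_) b∈
    ... | _ , d∈ , refl = n-equivariant π (ã⊆ d∈)

    #-⊆ : ∀ {x ã b̃} → ã ⊆ n x → b̃ # x → b̃ #ₜ ã
    #-⊆ ã⊆ = All.map (_∘ ã⊆)

module Matching {𝒩 : Set} {enum : ℕ ↔ 𝒩} {c ℓ} (O : OriginalPsiCalculus 𝒩 enum c ℓ) where
  open OriginalPsiCalculus O
  open NominalProperties (singleSorted 𝒩 enum)
  open SortedParameters (sortedParameters O) using (Match)

  Match-resp : ∀ {M N x̃ X Y L̃ Ñ} → M T.≈ N → X T.≈ Y → L̃ T.≋ Ñ →
               Match M x̃ X L̃ → Match N x̃ Y Ñ
  Match-resp M≈N X≈Y L̃≋Ñ ((x̃! , x̃~L̃) , M≈) =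
    (x̃! , Pointwise.transitive (λ _ _ → tt) x̃~L̃ L̃≋Ñ) ,
    T.trans (T.sym M≈N) (T.trans M≈ (SubstT.[]-cong X≈Y refl L̃≋Ñ))

  Match-equivariant : ∀ π {M x̃ X L̃} → Match M x̃ X L̃ →
                      Match (π T.∙ M) (π ∙ₜ x̃) (π T.∙ X) (map (π T.∙_) L̃)
  Match-equivariant π {X = X} ((x̃! , x̃~L̃) , M≈) =
    (Uniqueₚ.map⁺ (∙ₙ-injective π) x̃! ,
     Pointwise.map⁺ _ _ (Pointwise.map (λ _ → tt) x̃~L̃)) ,
    T.trans (T.∙-cong π M≈)
      (SubstT.equivariant π X _ _ refl (Pointwise.refl T.refl))

  Match-names : ∀ {M x̃ X Ñ} → x̃ ⊆ T.n X → Match M x̃ X Ñ → T.n* Ñ ⊆ T.n M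
  Match-names {X = X} x̃⊆ (_ , M≈) b∈ =
    n-resp 𝐓 (T.sym M≈) (preservesT X _ _ x̃⊆ b∈)

  Match-alpha : ∀ {M x̃ X Ñ} → x̃ ⊆ T.n X → Match M x̃ X Ñ →
                ∀ (πs : List Swapping) → x̃ ≡ map left πs →
                Unique (map right πs) → map right πs T.# X →
                Match M (map right πs) (πs T.∙* X) Ñ
  Match-alpha {X = X} x̃⊆ ((_ , x̃~Ñ) , M≈) πs refl ỹ! ỹ#X =
    q , T.trans M≈ (alphaT X _ πs (substitution _ _ q) refl refl
                     (Pointwise.refl T.refl) ỹ#X (#-⊆ 𝐓 x̃⊆ ỹ#X))
    where
    q : IsSubstitution (map right πs) _
    q = ỹ! , Pointwise.transitive (λ _ _ → tt)
               (Pointwise.map⁺ right left (Pointwise.refl {R = λ _ _ → ⊤} tt)) x̃~Ñ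

theorem2p7 : ∀ {c ℓ : Level} (𝒩 : Set) (enum : ℕ ↔ 𝒩)
    (O : OriginalPsiCalculus 𝒩 enum c ℓ) →
    KeepsNames O → IsSortedPsiCalculus (sortedParameters O)
theorem2p7 𝒩 enum O keepsNames = record
  { restrictable-isName = λ _ → tt
  ; SORTₜ-cong          = λ _ → refl
  ; SORTₜ-equivariant   = λ _ _ → refl
  ; SORTₓ-cong          = λ _ → refl
  ; SORTₓ-equivariant   = λ _ _ → refl
  ; vars-resp           = λ X≈Y x̃∼ỹ x̃⊆ b∈ →
                            n-resp 𝐓 X≈Y (x̃⊆ (Equivalence.from x̃∼ỹ b∈))
  ; vars-finite         = λ X → sublists (T.n X) , ⊆⇔∼sublist _≟_ (T.n X)
  ; vars-equivariant    = λ π {X} x̃⊆ → ∙ₜ-⊆-n 𝐓 π {X} x̃⊆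
  ; Match-resp          = Match-resp
  ; Match-equivariant   = Match-equivariant
  ; alphaT              = alphaT
  ; alphaC              = alphaC
  ; alphaA              = alphaA
  ; subst-sort          = λ _ _ _ → (λ _ → tt) , (λ _ → tt) , (λ _ → tt)
  ; substX-requirements = λ X σ x̃ x̃⊆ x̃#σ →
      (λ _ _ → tt) ,
      (λ b∈ → keepsNames X σ _ (x̃⊆ b∈) (All.lookup x̃#σ b∈)) ,
      alphaT X σ
  ; match-substitution  = λ _ _ → proj₁
  ; match-names         = λ x̃⊆ _ m _ b∈ → inj₁ (Match-names x̃⊆ m b∈)
  ; match-alpha         = λ x̃⊆ _ → Match-alpha x̃⊆
  }
  where
  open OriginalPsiCalculus O
  open NameUniverse (singleSorted 𝒩 enum) using (_≟_)
  open NominalProperties (singleSorted 𝒩 enum)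
  open Matching O
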